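{- Let $g:[0,1)^2\to(0,1)$ satisfy $g(x,y)+g(y,x)=1$ for all $x,y\in[0,1)$. The following statements are equivalent. 1. The rule $g$ is long-cycle-free on the sampled domain. 2. There is a function $h:[0,1)\to(0,\infty)$ such that $$g(x,y)=\frac{h(y)}{h(x)+h(y)}\qquad(x,y\in[0,1)).$$ The function $h$ is unique up to multiplication by a positive constant.
   Context: **Residual instances and proposals.** A finite weighted bipartite residual instance consists of disjoint finite sets $L,R$, a set $A\subseteq L\times R$ of available pairs, and nonnegative weights $w_{uv}$ on the pairs. Let every vertex $z\in L\cup R$ be assigned a rank $x_z\in[0,1)$ (distinct vertices may have equal ranks), and let a common total order on pairs be given for breaking ties. For a pair $uv$ the prospective gains are $$G_u(uv)=g(x_u,x_v)\,w_{uv},\qquad G_v(uv)=g(x_v,x_u)\,w_{uv}.$$ Every vertex incident to an available pair proposes along the available incident pair maximizing its own prospective gain, with ties resolved in favour of the pair that comes first in the common total order. The proposal graph has an arc from each proposing vertex to the other endpoint of the pair along which it proposes. A long proposal cycle is a directed cycle of length at least four in the proposal graph. **Long-cycle-free.** $g$ is long-cycle-free on the sampled domain if no long proposal cycle can arise in any finite weighted bipartite residual instance, under any assignment of ranks in $[0,1)$, and with any common total tie order. -}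

module Defs where

open import Algebra.Apartness.Structures using (IsHeytingField)
open import Data.Fin.Base using (Fin; zero; suc; inject₁; fromℕ)
open import Data.Nat.Base using (ℕ; zero; suc) renaming (_≤_ to _≤ᴺ_)
open import Data.Product.Base using (Σ; ∃-syntax; _×_; _,_; proj₁)
open import Data.Product.Relation.Binary.Pointwise.NonDependent using (_×ₛ_)
open import Data.Sum.Base using (_⊎_; inj₁; inj₂)
open import Function.Bundles using (Func; _⟨$⟩_)
open import Function.Definitions using (Injective)
open import Level using (Level; _⊔_; 0ℓ) renaming (suc to lsuc)
open import Relation.Binary.Bundles using (Setoid)
open import Relation.Binary.Core using (Rel; REL)
open import Relation.Binary.Definitions using (Decidable)
open import Relation.Binary.PropositionalEquality.Core using (_≡_)
open import Relation.Binary.Structures using (IsStrictPartialOrder; IsTotalOrder)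
open import Relation.Nullary.Negation.Core using (¬_)
import Relation.Binary.Construct.On as On

-- Apartness is x < y or y < x; by tightness (part of IsHeytingField) x ≈ y
-- holds exactly when neither x < y nor y < x.  The order is not assumed to be
-- decidable.
record OrderedField (c ℓ₁ ℓ₂ : Level) : Set (lsuc (c ⊔ ℓ₁ ⊔ ℓ₂)) where
  infix  4 _≈_ _<_ _≤_
  infixl 6 _+_
  infixl 7 _*_
  infix  8 -_
  field
    Carrier : Set c
    _≈_     : Rel Carrier ℓ₁
    _<_     : Rel Carrier ℓ₂
    _+_ _*_ : Carrier → Carrier → Carrier
    -_      : Carrier → Carrier
    0# 1#   : Carrier
    isHeytingField : IsHeytingField _≈_ (λ x y → x < y ⊎ y < x) _+_ _*_ -_ 0# 1#
    isStrictPartialOrder : IsStrictPartialOrder _≈_ _<_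
    +-monoˡ-< : ∀ {x y} z → x < y → x + z < y + z
    *-pos     : ∀ {x y} → 0# < x → 0# < y → 0# < x * y

  open IsHeytingField isHeytingField public renaming (zero to *-zero)
  open IsStrictPartialOrder isStrictPartialOrder public
    using (<-respʳ-≈; <-respˡ-≈)
    renaming (irrefl to <-irrefl; trans to <-trans)

  _≤_ : Rel Carrier ℓ₂
  x ≤ y = ¬ (y < x)

  fromNat : ℕ → Carrier
  fromNat zero    = 0#
  fromNat (suc n) = 1# + fromNat n

  -- This bounds |s m - s n|, since m and n may be exchanged.
  IsCauchy : (ℕ → Carrier) → Set (c ⊔ ℓ₂)
  IsCauchy s = ∀ ε → 0# < ε →
    ∃[ N ] (∀ m n → N ≤ᴺ m → N ≤ᴺ n → (s m - s n) < ε)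

  _ConvergesTo_ : (ℕ → Carrier) → Carrier → Set (c ⊔ ℓ₂)
  s ConvergesTo l = ∀ ε → 0# < ε →
    ∃[ N ] (∀ n → N ≤ᴺ n → (s n - l) < ε × (l - s n) < ε)

-- The real numbers are characterised axiomatically: a Cauchy complete
-- Archimedean ordered field is, classically, isomorphic to ℝ.
record RealNumbers (c ℓ₁ ℓ₂ : Level) : Set (lsuc (c ⊔ ℓ₁ ⊔ ℓ₂)) where
  field
    orderedField : OrderedField c ℓ₁ ℓ₂
  open OrderedField orderedField public
  field
    archimedean : ∀ x → ∃[ n ] x < fromNat n
    complete    : ∀ s → IsCauchy s → ∃[ l ] s ConvergesTo l

module _ {c ℓ₁ ℓ₂ : Level} (ℝ : RealNumbers c ℓ₁ ℓ₂) where
  open RealNumbers ℝ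

  private
    subsetoid : (Carrier → Set ℓ₂) → Setoid (c ⊔ ℓ₂) ℓ₁
    subsetoid P = On.setoid {B = Σ Carrier P} setoid proj₁

  [0,1⟩ ⟨0,1⟩ ⟨0,∞⟩ : Setoid (c ⊔ ℓ₂) ℓ₁
  [0,1⟩ = subsetoid (λ x → 0# ≤ x × x < 1#)
  ⟨0,1⟩ = subsetoid (λ x → 0# < x × x < 1#)
  ⟨0,∞⟩ = subsetoid (λ x → 0# < x)

  Rank Positive : Set (c ⊔ ℓ₂)
  Rank     = Setoid.Carrier [0,1⟩
  Positive = Setoid.Carrier ⟨0,∞⟩

  infixl 6 _+⁺_
  _+⁺_ : Positive → Positive → Positive
  (x , 0<x) +⁺ (y , 0<y) =
    x + y , <-trans 0<y (<-respˡ-≈ (+-identityˡ y) (+-monoˡ-< y 0<x))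

  -- The library attaches an inverse to each apart pair, here y and 0#: it is
  -- an inverse of their difference y + (- 0#), that is, of y.
  infixl 7 _/_
  _/_ : Carrier → Positive → Carrier
  x / (y , 0<y) = x * proj₁ (#⇒invertible {x = y} {y = 0#} (inj₂ 0<y))

  Rule : Set (c ⊔ ℓ₁ ⊔ ℓ₂)
  Rule = Func ([0,1⟩ ×ₛ [0,1⟩) ⟨0,1⟩

  ⟦_⟧ : Rule → Rank → Rank → Carrier
  ⟦ g ⟧ x y = proj₁ (g ⟨$⟩ (x , y))

  -- The two sides are L = Fin m and R = Fin n.  Only the weights of available
  -- pairs are ever compared.
  record ResidualInstance (m n : ℕ) : Set (c ⊔ ℓ₂ ⊔ lsuc 0ℓ) where
    field
      Available  : REL (Fin m) (Fin n) 0ℓ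
      available? : Decidable Available
      weight     : Fin m → Fin n → Carrier
      weight≥0   : ∀ u v → 0# ≤ weight u v

  Vertex : ℕ → ℕ → Set
  Vertex m n = Fin m ⊎ Fin n

  Pair : ℕ → ℕ → Set
  Pair m n = Fin m × Fin n

  Incident : ∀ {m n} → Vertex m n → Pair m n → Set
  Incident (inj₁ u) (u′ , _) = u ≡ u′
  Incident (inj₂ v) (_ , v′) = v ≡ v′

  -- The endpoint of a pair on the opposite side from the given vertex.
  otherEnd : ∀ {m n} → Vertex m n → Pair m n → Vertex m n
  otherEnd (inj₁ _) (_ , v) = inj₂ v
  otherEnd (inj₂ _) (u , _) = inj₁ u

  module Proposals (g : Rule) {m n : ℕ} (I : ResidualInstance m n)
                   (rank : Vertex m n → Rank) (_≼_ : Rel (Pair m n) 0ℓ) where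
    open ResidualInstance I

    -- The prospective gain; meaningful when the vertex is an end of the pair.
    gain : Vertex m n → Pair m n → Carrier
    gain z (u , v) = ⟦ g ⟧ (rank z) (rank (otherEnd z (u , v))) * weight u v

    AvailableAt : Vertex m n → Pair m n → Set
    AvailableAt z (u , v) = Incident z (u , v) × Available u v

    ProposesAlong : Vertex m n → Pair m n → Set (ℓ₁ ⊔ ℓ₂)
    ProposesAlong z e = AvailableAt z e ×
      (∀ e′ → AvailableAt z e′ → gain z e′ ≤ gain z e × (gain z e′ ≈ gain z e → e ≼ e′))

    Arc : Vertex m n → Vertex m n → Set (ℓ₁ ⊔ ℓ₂)
    Arc z z′ = ∃[ e ] ProposesAlong z e × z′ ≡ otherEnd z e

    -- A directed cycle of length suc k, listed by its distinct vertices.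
    record LongProposalCycle : Set (ℓ₁ ⊔ ℓ₂) where
      field
        k         : ℕ
        long      : 4 ≤ᴺ suc k
        vertex    : Fin (suc k) → Vertex m n
        injective : Injective _≡_ _≡_ vertex
        step      : ∀ (i : Fin k) → Arc (vertex (inject₁ i)) (vertex (suc i))
        close     : Arc (vertex (fromℕ k)) (vertex zero)

  LongCycleFree : Rule → Set (c ⊔ ℓ₁ ⊔ ℓ₂ ⊔ lsuc 0ℓ)
  LongCycleFree g =
    ∀ {m n} (I : ResidualInstance m n) (rank : Vertex m n → Rank)
      (_≼_ : Rel (Pair m n) 0ℓ) → IsTotalOrder _≡_ _≼_ →
      ¬ Proposals.LongProposalCycle g I rank _≼_

  Represents : Func [0,1⟩ ⟨0,∞⟩ → Rule → Set (c ⊔ ℓ₁ ⊔ ℓ₂)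
  Represents h g = ∀ x y →
    ⟦ g ⟧ x y ≈ proj₁ (h ⟨$⟩ y) / ((h ⟨$⟩ x) +⁺ (h ⟨$⟩ y))

{-# OPTIONS --safe #-}

-- Write G for the rule.  Given G x y + G y x = 1, the function h represents G
-- exactly when h x * G x y = h y * G y x.
--
-- If such an h exists, scaling the gains of each vertex z by h (rank z) > 0 does
-- not change its proposal, and the scaled gains along a pair agree at both of
-- its ends.  All vertices therefore optimise one common order on the pairs; the
-- pairs of a long proposal cycle only improve in this order, so they coincide,
-- whereas consecutive pairs of a long cycle are distinct.
--
-- Conversely, take the hexagon whose opposite vertices have equal ranks, the
-- ranks of three consecutive vertices being x, y, z.  Its weights can be chosen
-- so that the two prospective gains tie at the vertices of rank x or z, while at
-- those of rank y the next pair is better exactly when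
-- G y x * G x z * G z y < G y z * G z x * G x y.  Without long cycles these two
-- products are equal for all x, y, z, and h y = G 0 y / G y 0 represents G.
module Submission where

open import Defs
open import Algebra.Apartness.Bundles using (HeytingCommutativeRing)
import Algebra.Apartness.Properties.HeytingCommutativeRing as HeytingProperties
open import Algebra.Bundles using (CommutativeRing)
import Algebra.Properties.CommutativeSemigroup as CommutativeSemigroupProperties
import Algebra.Properties.Ring as RingProperties
import Algebra.Solver.Ring.NaturalCoefficients.Default as SemiringSolver
open import Data.Empty using (⊥-elim)
open import Data.Fin.Base as Fin using (Fin; zero; suc; inject₁; fromℕ; toℕ; combine)
open import Data.Fin.Patterns using (0F; 1F; 2F; 3F; 4F)
open import Data.Fin.Properties as Fin using (all?; combine-injective; ≤-isTotalOrder)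
open import Data.Nat.Base using (ℕ; zero; suc; z≤n; s≤s) renaming (_+_ to _+ᴺ_)
import Data.Nat.Properties as ℕ
open import Data.Product.Base using (Σ-syntax; _×_; _,_; proj₁; proj₂)
open import Data.Sum.Base using (inj₁; inj₂; [_,_]′)
import Data.Sum.Properties as Sum
open import Data.Vec.Base using ([]; _∷_; lookup)
open import Function.Base using (_∘_; _on_; id)
open import Function.Bundles using (Func; _⇔_; _⟨$⟩_; mk⇔)
open import Function.Definitions using (Injective)
open import Level using (Level; 0ℓ)
open import Relation.Binary.Core using (Rel)
open import Relation.Binary.Morphism.Structures using (IsOrderMonomorphism)
import Relation.Binary.Morphism.OrderMonomorphism as OrderMonomorphism
open import Relation.Binary.PropositionalEquality as ≡ using (_≡_; _≢_; ≢-sym)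
import Relation.Binary.Reasoning.Setoid as ≈-Reasoning
open import Relation.Binary.Structures using (IsTotalOrder)
open import Relation.Nullary.Decidable using (from-yes; ¬?; _→-dec_)
open import Relation.Nullary.Negation.Core using (¬_)

-- Order and multiplication in an ordered field with undecided order.

module OrderedFieldProperties {c ℓ₁ ℓ₂ : Level} (F : OrderedField c ℓ₁ ℓ₂) where
  open OrderedField F

  private
    commutativeRing : CommutativeRing c ℓ₁
    commutativeRing = record { isCommutativeRing = isCommutativeRing }

    heytingCommutativeRing : HeytingCommutativeRing c ℓ₁ ℓ₂
    heytingCommutativeRing = record { isHeytingCommutativeRing = isHeytingCommutativeRing }

  open CommutativeRing commutativeRing public
    using (ring; commutativeSemiring; *-commutativeSemigroup)
  open RingProperties ring public using (+-cancelʳ)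
  open RingProperties ring using (-‿involutive; -‿distribˡ-*; x[y-z]≈xy-xz)
  open CommutativeSemigroupProperties *-commutativeSemigroup public
    using (x∙yz≈y∙xz; x∙yz≈z∙xy)
  open HeytingProperties heytingCommutativeRing using (1#0; x-0≈x)
  open SemiringSolver commutativeSemiring public using (solve; _:*_; _:+_; _:=_)
  open ≈-Reasoning setoid

  <⇒≤ : ∀ {x y} → x < y → x ≤ y
  <⇒≤ x<y y<x = <-irrefl refl (<-trans x<y y<x)

  ≤-reflexive : ∀ {x y} → x ≈ y → x ≤ y
  ≤-reflexive x≈y y<x = <-irrefl (sym x≈y) y<x

  -- As `≤` is the negation of `<`, cotransitivity of apartness has to locate `y` relative to a
  -- supposed `z < x`.
  ≤-trans : ∀ {x y z} → x ≤ y → y ≤ z → x ≤ z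
  ≤-trans {x} {y} {z} x≤y y≤z z<x with #-cotrans (inj₁ z<x) y
  ... | inj₁ (inj₁ z<y) = y≤z z<y
  ... | inj₁ (inj₂ y<z) = x≤y (<-trans y<z z<x)
  ... | inj₂ (inj₁ y<x) = x≤y y<x
  ... | inj₂ (inj₂ x<y) = y≤z (<-trans z<x x<y)

  ≤-antisym : ∀ {x y} → x ≤ y → y ≤ x → x ≈ y
  ≤-antisym {x} {y} x≤y y≤x =
    proj₁ (tight x y) λ { (inj₁ x<y) → y≤x x<y ; (inj₂ y<x) → x≤y y<x }

  ≤-respˡ-≈ : ∀ {x y z} → x ≈ y → x ≤ z → y ≤ z
  ≤-respˡ-≈ x≈y x≤z z<y = x≤z (<-respʳ-≈ (sym x≈y) z<y)

  ≤-respʳ-≈ : ∀ {x y z} → y ≈ z → x ≤ y → x ≤ z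
  ≤-respʳ-≈ y≈z x≤y z<x = x≤y (<-respˡ-≈ (sym y≈z) z<x)

  x<y⇒0<y-x : ∀ {x y} → x < y → 0# < y - x
  x<y⇒0<y-x {x} x<y = <-respˡ-≈ (-‿inverseʳ x) (+-monoˡ-< (- x) x<y)

  0<y-x⇒x<y : ∀ {x y} → 0# < y - x → x < y
  0<y-x⇒x<y {x} {y} 0<y-x = <-respˡ-≈ (+-identityˡ x) (<-respʳ-≈ y-x+x≈y (+-monoˡ-< x 0<y-x))
    where
    y-x+x≈y : y - x + x ≈ y
    y-x+x≈y = begin
      y - x + x      ≈⟨ +-assoc y (- x) x ⟩
      y + (- x + x)  ≈⟨ +-congˡ (-‿inverseˡ x) ⟩
      y + 0#         ≈⟨ +-identityʳ y ⟩
      y              ∎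

  *-monoˡ-< : ∀ {x y z} → 0# < z → x < y → z * x < z * y
  *-monoˡ-< {x} {y} {z} 0<z x<y =
    0<y-x⇒x<y (<-respʳ-≈ (x[y-z]≈xy-xz z y x) (*-pos 0<z (x<y⇒0<y-x x<y)))

  0<1 : 0# < 1#
  0<1 with 1#0
  ... | inj₂ 0<1 = 0<1
  ... | inj₁ 1<0 = <-respʳ-≈ -1*-1≈1 (*-pos 0<-1 0<-1)
    where
    0<-1 : 0# < - 1#
    0<-1 = <-respʳ-≈ (+-identityˡ (- 1#)) (x<y⇒0<y-x 1<0)

    -1*-1≈1 : - 1# * - 1# ≈ 1#
    -1*-1≈1 = begin
      - 1# * - 1#    ≈⟨ -‿distribˡ-* 1# (- 1#) ⟨
      - (1# * - 1#)  ≈⟨ -‿cong (*-identityˡ (- 1#)) ⟩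
      - (- 1#)       ≈⟨ -‿involutive 1# ⟩
      1#             ∎

  module Inverse {y} (0<y : 0# < y) where
    inverse : Carrier
    inverse = proj₁ (#⇒invertible {x = y} {y = 0#} (inj₂ 0<y))

    inverseˡ : inverse * y ≈ 1#
    inverseˡ = trans (*-congˡ (sym (x-0≈x y))) (proj₁ (proj₂ (#⇒invertible (inj₂ 0<y))))

    inverseʳ : y * inverse ≈ 1#
    inverseʳ = trans (*-comm y inverse) inverseˡ

    inverse-pos : 0# < inverse
    inverse-pos with invertible⇒# {x = inverse} {y = 0#}
      ( y , trans (*-congˡ (x-0≈x inverse)) inverseʳ
          , trans (*-congʳ (x-0≈x inverse)) inverseˡ)
    ... | inj₂ 0<inverse = 0<inverse
    -- A negative inverse, multiplied by `y`, would give `1# < 0#`.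
    ... | inj₁ inverse<0 = ⊥-elim (<⇒≤ 0<1
      (<-respˡ-≈ inverseʳ (<-respʳ-≈ (zeroʳ y) (*-monoˡ-< 0<y inverse<0))))

    inverse-cancelˡ : ∀ x → inverse * (y * x) ≈ x
    inverse-cancelˡ x = begin
      inverse * (y * x)  ≈⟨ *-assoc inverse y x ⟨
      inverse * y * x    ≈⟨ *-congʳ inverseˡ ⟩
      1# * x             ≈⟨ *-identityˡ x ⟩
      x                  ∎

  open Inverse

  *-monoˡ-≤ : ∀ {x y z} → 0# < z → x ≤ y → z * x ≤ z * y
  *-monoˡ-≤ {x} {y} 0<z x≤y zy<zx = x≤y
    (<-respˡ-≈ (inverse-cancelˡ 0<z y) (<-respʳ-≈ (inverse-cancelˡ 0<z x)
      (*-monoˡ-< (inverse-pos 0<z) zy<zx)))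

  *-cancelˡ-≈ : ∀ {x y z} → 0# < z → z * x ≈ z * y → x ≈ y
  *-cancelˡ-≈ {x} {y} 0<z zx≈zy =
    trans (sym (inverse-cancelˡ 0<z x)) (trans (*-congˡ zx≈zy) (inverse-cancelˡ 0<z y))

-- Division by positive numbers.

module _ {c ℓ₁ ℓ₂ : Level} (ℝ : RealNumbers c ℓ₁ ℓ₂) where
  open RealNumbers ℝ
  open OrderedFieldProperties orderedField
  open ≈-Reasoning setoid

  private
    infixl 7 _÷_
    _÷_ : Carrier → Positive ℝ → Carrier
    _÷_ = _/_ ℝ

  ÷-* : ∀ x p → x ÷ p * proj₁ p ≈ x
  ÷-* x (y , 0<y) = begin
    x * inverse * y    ≈⟨ *-assoc x inverse y ⟩
    x * (inverse * y)  ≈⟨ *-congˡ inverseˡ ⟩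
    x * 1#             ≈⟨ *-identityʳ x ⟩
    x                  ∎
    where open Inverse 0<y

  ÷-unique : ∀ {x z} p → z * proj₁ p ≈ x → z ≈ x ÷ p
  ÷-unique {x} {z} p zp≈x = *-cancelˡ-≈ (proj₂ p) (begin
    proj₁ p * z        ≈⟨ *-comm (proj₁ p) z ⟩
    z * proj₁ p        ≈⟨ zp≈x ⟩
    x                  ≈⟨ ÷-* x p ⟨
    x ÷ p * proj₁ p    ≈⟨ *-comm (x ÷ p) (proj₁ p) ⟩
    proj₁ p * (x ÷ p)  ∎)

  -- The inverse is built from the positivity proof too, so equal denominators are compared through
  -- uniqueness of the quotient.
  ÷-cong : ∀ {x x′} p p′ → x ≈ x′ → proj₁ p ≈ proj₁ p′ → x ÷ p ≈ x′ ÷ p′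
  ÷-cong {x} {x′} p p′ x≈x′ p≈p′ = ÷-unique p′ (begin
    x ÷ p * proj₁ p′  ≈⟨ *-congˡ p≈p′ ⟨
    x ÷ p * proj₁ p   ≈⟨ ÷-* x p ⟩
    x                 ≈⟨ x≈x′ ⟩
    x′                ∎)

  infixl 7 _÷⁺_
  _÷⁺_ : Positive ℝ → Positive ℝ → Positive ℝ
  (x , 0<x) ÷⁺ p = x ÷ p , *-pos 0<x (Inverse.inverse-pos (proj₂ p))

  cross-multiply : ∀ {x y u v} p q → proj₁ q * (x * u) ≈ v * (proj₁ p * y) →
                   x ÷ p * u ≈ y ÷ q * v
  cross-multiply {x} {y} {u} {v} p q eq = *-cancelˡ-≈ (proj₂ q) (*-cancelˡ-≈ (proj₂ p) (begin
    proj₁ p * (proj₁ q * (x ÷ p * u))  ≈⟨ solve 4 (λ p q x u → p :* (q :* (x :* u)) := q :* (x :* p :* u)) refl (proj₁ p) (proj₁ q) (x ÷ p) u ⟩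
    proj₁ q * (x ÷ p * proj₁ p * u)    ≈⟨ *-congˡ (*-congʳ (÷-* x p)) ⟩
    proj₁ q * (x * u)                  ≈⟨ eq ⟩
    v * (proj₁ p * y)                  ≈⟨ *-congˡ (*-congˡ (÷-* y q)) ⟨
    v * (proj₁ p * (y ÷ q * proj₁ q))  ≈⟨ solve 4 (λ p q y v → v :* (p :* (y :* q)) := p :* (q :* (y :* v))) refl (proj₁ p) (proj₁ q) (y ÷ q) v ⟩
    proj₁ p * (proj₁ q * (y ÷ q * v))  ∎))

  0ᴿ : Rank ℝ
  0ᴿ = 0# , <-irrefl refl , 0<1

  -- The balance equation: equivalence with representation, and uniqueness.

  module _ (g : Rule ℝ) where
    private
      G : Rank ℝ → Rank ℝ → Carrier
      G = ⟦_⟧ ℝ g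

    G-pos : ∀ x y → 0# < G x y
    G-pos x y = proj₁ (proj₂ (g ⟨$⟩ (x , y)))

    -- The detailed balance equation of a reversible Markov chain, a division-free form of
    -- `Represents`.
    Balanced : (Rank ℝ → Positive ℝ) → Set _
    Balanced h = ∀ x y → proj₁ (h x) * G x y ≈ proj₁ (h y) * G y x

    module _ (complementary : ∀ x y → G x y + G y x ≈ 1#) where

      G*[h+h] : ∀ (h : Rank ℝ → Positive ℝ) x y →
        G x y * (proj₁ (h x) + proj₁ (h y)) ≈ proj₁ (h x) * G x y + proj₁ (h y) * G x y
      G*[h+h] h x y = solve 3 (λ s a b → s :* (a :+ b) := a :* s :+ b :* s) refl
        (G x y) (proj₁ (h x)) (proj₁ (h y))

      h≈h*G+h*G : ∀ (h : Rank ℝ → Positive ℝ) x y →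
        proj₁ (h y) ≈ proj₁ (h y) * G y x + proj₁ (h y) * G x y
      h≈h*G+h*G h x y = begin
        proj₁ (h y)                                  ≈⟨ *-identityʳ (proj₁ (h y)) ⟨
        proj₁ (h y) * 1#                             ≈⟨ *-congˡ (complementary y x) ⟨
        proj₁ (h y) * (G y x + G x y)                ≈⟨ distribˡ (proj₁ (h y)) (G y x) (G x y) ⟩
        proj₁ (h y) * G y x + proj₁ (h y) * G x y    ∎

      -- Clear the denominator and split `h y` by complementarity: the term `h y * G x y` occurs on
      -- both sides and cancels.
      represents⇒balanced : ∀ h → Represents ℝ h g → Balanced (h ⟨$⟩_)
      represents⇒balanced h rep x y = +-cancelʳ (proj₁ (h ⟨$⟩ y) * G x y) _ _ (begin
        proj₁ (h ⟨$⟩ x) * G x y + proj₁ (h ⟨$⟩ y) * G x y  ≈⟨ G*[h+h] (h ⟨$⟩_) x y ⟨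
        G x y * (proj₁ (h ⟨$⟩ x) + proj₁ (h ⟨$⟩ y))        ≈⟨ *-congʳ (rep x y) ⟩
        proj₁ (h ⟨$⟩ y) ÷ s * proj₁ s                      ≈⟨ ÷-* (proj₁ (h ⟨$⟩ y)) s ⟩
        proj₁ (h ⟨$⟩ y)                                    ≈⟨ h≈h*G+h*G (h ⟨$⟩_) x y ⟩
        proj₁ (h ⟨$⟩ y) * G y x + proj₁ (h ⟨$⟩ y) * G x y  ∎)
        where
        s : Positive ℝ
        s = _+⁺_ ℝ (h ⟨$⟩ x) (h ⟨$⟩ y)

      balanced⇒represents : ∀ h → Balanced (h ⟨$⟩_) → Represents ℝ h g
      balanced⇒represents h bal x y = ÷-unique (_+⁺_ ℝ (h ⟨$⟩ x) (h ⟨$⟩ y)) (begin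
        G x y * (proj₁ (h ⟨$⟩ x) + proj₁ (h ⟨$⟩ y))        ≈⟨ G*[h+h] (h ⟨$⟩_) x y ⟩
        proj₁ (h ⟨$⟩ x) * G x y + proj₁ (h ⟨$⟩ y) * G x y  ≈⟨ +-congʳ (bal x y) ⟩
        proj₁ (h ⟨$⟩ y) * G y x + proj₁ (h ⟨$⟩ y) * G x y  ≈⟨ h≈h*G+h*G (h ⟨$⟩_) x y ⟨
        proj₁ (h ⟨$⟩ y)                                    ∎)

    -- Balance between `x` and the base rank `0ᴿ` determines `h x` from `h 0ᴿ`, so the constant is
    -- the quotient of the two values at `0ᴿ`.
    balanced-unique : ∀ h h′ → Balanced h → Balanced h′ →
      Σ[ a ∈ Positive ℝ ] (∀ x → proj₁ (h′ x) ≈ proj₁ a * proj₁ (h x))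
    balanced-unique h h′ bal bal′ = a , λ x → *-cancelˡ-≈ (G-pos x 0ᴿ) (begin
      G x 0ᴿ * proj₁ (h′ x)              ≈⟨ *-comm (G x 0ᴿ) (proj₁ (h′ x)) ⟩
      proj₁ (h′ x) * G x 0ᴿ              ≈⟨ bal′ x 0ᴿ ⟩
      proj₁ (h′ 0ᴿ) * G 0ᴿ x             ≈⟨ *-congʳ (÷-* (proj₁ (h′ 0ᴿ)) (h 0ᴿ)) ⟨
      proj₁ a * proj₁ (h 0ᴿ) * G 0ᴿ x    ≈⟨ *-assoc (proj₁ a) (proj₁ (h 0ᴿ)) (G 0ᴿ x) ⟩
      proj₁ a * (proj₁ (h 0ᴿ) * G 0ᴿ x)  ≈⟨ *-congˡ (bal x 0ᴿ) ⟨
      proj₁ a * (proj₁ (h x) * G x 0ᴿ)   ≈⟨ x∙yz≈z∙xy (proj₁ a) (proj₁ (h x)) (G x 0ᴿ) ⟩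
      G x 0ᴿ * (proj₁ a * proj₁ (h x))   ∎)
      where
      a : Positive ℝ
      a = h′ 0ᴿ ÷⁺ h 0ᴿ

    -- A balanced function excludes long cycles.

    module CommonOrder (h : Rank ℝ → Positive ℝ) (balanced : Balanced h)
                       {m n : ℕ} (I : ResidualInstance ℝ m n)
                       (rank : Vertex ℝ m n → Rank ℝ) (_≼_ : Rel (Pair ℝ m n) 0ℓ)
                       (≼-isTotalOrder : IsTotalOrder _≡_ _≼_) where
      open ResidualInstance I
      open Proposals ℝ g I rank _≼_
      private module ≼ = IsTotalOrder ≼-isTotalOrder

      potential : Pair ℝ m n → Carrier
      potential (u , v) = proj₁ (h (rank (inj₁ u))) * gain (inj₁ u) (u , v)

      scaled-gain : ∀ (z : Vertex ℝ m n) e → Incident ℝ z e → proj₁ (h (rank z)) * gain z e ≈ potential e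
      scaled-gain (inj₁ _) (_ , _) ≡.refl = refl
      scaled-gain (inj₂ _) (u , v) ≡.refl = begin
        proj₁ (h y) * (G y x * weight u v)  ≈⟨ *-assoc _ _ _ ⟨
        proj₁ (h y) * G y x * weight u v    ≈⟨ *-congʳ (balanced y x) ⟩
        proj₁ (h x) * G x y * weight u v    ≈⟨ *-assoc _ _ _ ⟩
        proj₁ (h x) * (G x y * weight u v)  ∎
        where
        x y : Rank ℝ
        x = rank (inj₁ u)
        y = rank (inj₂ v)

      infix 4 _⊑_
      -- Better pairs are larger. The tie order enters reversed because a tie goes to the pair that
      -- comes first.
      _⊑_ : Pair ℝ m n → Pair ℝ m n → Set _
      e ⊑ e′ = potential e ≤ potential e′ × (potential e ≈ potential e′ → e′ ≼ e)

      ⊑-refl : ∀ {e} → e ⊑ e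
      ⊑-refl = <-irrefl refl , λ _ → ≼.refl

      ⊑-trans : ∀ {e e′ e″} → e ⊑ e′ → e′ ⊑ e″ → e ⊑ e″
      -- If the outer potentials agree, the middle one is squeezed between them, so both tie clauses
      -- apply.
      ⊑-trans {e} {e′} {e″} (p , t) (q , s) = ≤-trans p q , λ e≈e″ →
        ≼.trans (s (≤-antisym q (≤-respˡ-≈ e≈e″ p))) (t (≤-antisym p (≤-respʳ-≈ (sym e≈e″) q)))

      ⊑-antisym : ∀ {e e′} → e ⊑ e′ → e′ ⊑ e → e ≡ e′
      ⊑-antisym (p , t) (q , s) = ≼.antisym (s (≤-antisym q p)) (t (≤-antisym p q))

      ⊑-path : ∀ {k} (f : Fin (suc k) → Pair ℝ m n) →
               (∀ i → f (inject₁ i) ⊑ f (suc i)) → f zero ⊑ f (fromℕ k)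
      ⊑-path {zero}  f f⊑ = ⊑-refl
      ⊑-path {suc k} f f⊑ = ⊑-trans (f⊑ zero) (⊑-path (f ∘ suc) (f⊑ ∘ suc))

      -- Scaling by `h (rank z) > 0` preserves inequalities between gains and reflects ties.
      proposal-maximal : ∀ z {e e′} → ProposesAlong z e → AvailableAt z e′ → e′ ⊑ e
      proposal-maximal z {e} {e′} ((z∈e , _) , best) e′-available@(z∈e′ , _) =
        ≤-respˡ-≈ φ′ (≤-respʳ-≈ φ (*-monoˡ-≤ 0<h (proj₁ (best e′ e′-available)))) ,
        λ φ′≈φ → proj₂ (best e′ e′-available)
          (*-cancelˡ-≈ 0<h (trans φ′ (trans φ′≈φ (sym φ))))
        where
        0<h : 0# < proj₁ (h (rank z))
        0<h = proj₂ (h (rank z))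
        φ : proj₁ (h (rank z)) * gain z e ≈ potential e
        φ = scaled-gain z e z∈e
        φ′ : proj₁ (h (rank z)) * gain z e′ ≈ potential e′
        φ′ = scaled-gain z e′ z∈e′

      available-at-otherEnd : ∀ z e → AvailableAt z e → AvailableAt (otherEnd ℝ z e) e
      available-at-otherEnd (inj₁ _) (_ , _) (_ , available) = ≡.refl , available
      available-at-otherEnd (inj₂ _) (_ , _) (_ , available) = ≡.refl , available

      otherEnd-involutive : ∀ (z : Vertex ℝ m n) e → Incident ℝ z e → otherEnd ℝ (otherEnd ℝ z e) e ≡ z
      otherEnd-involutive (inj₁ _) (_ , _) ≡.refl = ≡.refl
      otherEnd-involutive (inj₂ _) (_ , _) ≡.refl = ≡.refl

      -- The pair of the first arc is itself an option at the vertex where the second arc starts.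
      arc-⊑ : ∀ {z z′ z″} (a : Arc z z′) (a′ : Arc z′ z″) → proj₁ a ⊑ proj₁ a′
      arc-⊑ {z} (e , (e-available , _) , ≡.refl) (_ , proposes′ , _) =
        proposal-maximal (otherEnd ℝ z e) proposes′ (available-at-otherEnd z e e-available)

      arc-backtrack : ∀ {z z′ z″} (a : Arc z z′) (a′ : Arc z′ z″) →
                      proj₁ a ≡ proj₁ a′ → z″ ≡ z
      arc-backtrack {z} (e , ((z∈e , _) , _) , ≡.refl) (_ , _ , ≡.refl) ≡.refl =
        otherEnd-involutive z e z∈e

      no-long-cycle : ¬ LongProposalCycle
      no-long-cycle record { k = suc (suc k) ; injective = inj ; step = step ; close = close }
        with inj (arc-backtrack (step 0F) (step 1F) (⊑-antisym (arc-⊑ (step 0F) (step 1F)) e₁⊑e₀))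
        where
        e₁⊑e₀ : proj₁ (step 1F) ⊑ proj₁ (step 0F)
        -- Follow the cycle from its second pair to its last listed one, then through the closing
        -- pair back to the first. Equality of the first two pairs would identify vertices 0 and 2.
        e₁⊑e₀ = ⊑-trans
          (⊑-path (λ i → proj₁ (step (suc i))) (λ i → arc-⊑ (step (suc (inject₁ i))) (step (suc (suc i)))))
          (⊑-trans (arc-⊑ (step (fromℕ (suc k))) close) (arc-⊑ close (step 0F)))
      ... | ()
      no-long-cycle record { k = 0 ; long = s≤s () }
      no-long-cycle record { k = 1 ; long = s≤s (s≤s ()) }

    balanced⇒longCycleFree : ∀ h → Balanced h → LongCycleFree ℝ g
    balanced⇒longCycleFree h bal I rank _≼_ isTotalOrder =
      CommonOrder.no-long-cycle h bal I rank _≼_ isTotalOrder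

    -- A hexagon turning a strict gap into a long cycle.

    -- Both sides carry the labels 0, 1, 2, the label determines the rank, and the
    -- pairs with distinct labels form the hexagon L0 R1 L2 R0 L1 R2.
    module Hexagon (x y z : Rank ℝ)
                   (gap : G y x * (G x z * G z y) < G y z * (G z x * G x y)) where

      ρ : Fin 3 → Rank ℝ
      ρ 0F = x
      ρ 1F = y
      ρ 2F = z

      -- For distinct labels the sum of the labels determines the pair.
      side : ℕ → Carrier
      side 1 = G x z * G z y
      side 2 = G x y * G z y
      side _ = G z x * G x y

      0<side : ∀ s → 0# < side s
      0<side 0 = *-pos (G-pos z x) (G-pos x y)
      0<side 1 = *-pos (G-pos x z) (G-pos z y)
      0<side 2 = *-pos (G-pos x y) (G-pos z y)
      0<side (suc (suc (suc _))) = *-pos (G-pos z x) (G-pos x y)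

      weight : Fin 3 → Fin 3 → Carrier
      weight i j = side (toℕ i +ᴺ toℕ j)

      weight-sym : ∀ i j → weight i j ≡ weight j i
      weight-sym i j = ≡.cong side (ℕ.+-comm (toℕ i) (toℕ j))

      hexagon : ResidualInstance ℝ 3 3
      hexagon = record
        { Available  = _≢_
        ; available? = λ i j → ¬? (i Fin.≟ j)
        ; weight     = weight
        ; weight≥0   = λ i j → <⇒≤ (0<side (toℕ i +ᴺ toℕ j))
        }

      -- With either end fixed, the smaller partner comes first. This sends the tie at label 0 to 1
      -- and the tie at label 2 to 0, in both cases to the `next` label.
      lex : Pair ℝ 3 3 → Fin 9
      lex (i , j) = combine i j

      infix 4 _≼_
      _≼_ : Rel (Pair ℝ 3 3) 0ℓ
      _≼_ = Fin._≤_ on lex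

      ≼-isTotalOrder : IsTotalOrder _≡_ _≼_
      ≼-isTotalOrder = OrderMonomorphism.isTotalOrder lex-isOrderMonomorphism ≤-isTotalOrder
        where
        lex-isOrderMonomorphism : IsOrderMonomorphism _≡_ _≡_ _≼_ Fin._≤_ lex
        lex-isOrderMonomorphism = record
          { isOrderHomomorphism = record { cong = ≡.cong lex ; mono = id }
          ; injective = λ {(i , j)} {(k , l)} eq →
              let i≡k , j≡l = combine-injective i j k l eq in ≡.cong₂ _,_ i≡k j≡l
          ; cancel = id
          }

      next : Fin 3 → Fin 3
      next 0F = 1F
      next 1F = 2F
      next 2F = 0F

      i≢next[i] : ∀ i → i ≢ next i
      i≢next[i] 0F ()
      i≢next[i] 1F ()
      i≢next[i] 2F ()

      labelGain : Fin 3 → Fin 3 → Carrier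
      labelGain i j = G (ρ i) (ρ j) * weight i j

      -- At labels 0 and 2 both gains are the same three factors in different orders, so the tie
      -- order decides; at label 1 the strict `gap` decides. The symmetry of the weights lets one
      -- comparison serve both sides.
      prefers-next : ∀ i j → i ≢ j → labelGain i j ≤ labelGain i (next i) ×
        (labelGain i j ≈ labelGain i (next i) → (i , next i) ≼ (i , j) × (next i , i) ≼ (j , i))
      prefers-next 0F 0F 0≢0 = ⊥-elim (0≢0 ≡.refl)
      prefers-next 1F 1F 1≢1 = ⊥-elim (1≢1 ≡.refl)
      prefers-next 2F 2F 2≢2 = ⊥-elim (2≢2 ≡.refl)
      prefers-next 0F 1F _ = <-irrefl refl , λ _ → ℕ.≤-refl , ℕ.≤-refl
      prefers-next 1F 2F _ = <-irrefl refl , λ _ → ℕ.≤-refl , ℕ.≤-refl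
      prefers-next 2F 0F _ = <-irrefl refl , λ _ → ℕ.≤-refl , ℕ.≤-refl
      prefers-next 1F 0F _ = <⇒≤ gap , λ eq → ⊥-elim (<-irrefl eq gap)
      prefers-next 0F 2F _ = ≤-reflexive (x∙yz≈y∙xz (G x z) (G x y) (G z y)) ,
        λ _ → from-yes (lex (0F , 1F) Fin.≤? lex (0F , 2F)) , from-yes (lex (1F , 0F) Fin.≤? lex (2F , 0F))
      prefers-next 2F 1F _ = ≤-reflexive (sym (x∙yz≈z∙xy (G z x) (G x y) (G z y))) ,
        λ _ → from-yes (lex (2F , 0F) Fin.≤? lex (2F , 1F)) , from-yes (lex (0F , 2F) Fin.≤? lex (1F , 2F))

      open Proposals ℝ g hexagon [ ρ , ρ ]′ _≼_

      arcˡ : ∀ i → Arc (inj₁ i) (inj₂ (next i))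
      arcˡ i = (i , next i) , ((≡.refl , i≢next[i] i) , best) , ≡.refl
        where
        best : ∀ e → AvailableAt (inj₁ i) e →
               gain (inj₁ i) e ≤ labelGain i (next i) ×
               (gain (inj₁ i) e ≈ labelGain i (next i) → (i , next i) ≼ e)
        best (_ , j) (≡.refl , i≢j) =
          proj₁ (prefers-next i j i≢j) , proj₁ ∘ proj₂ (prefers-next i j i≢j)

      arcʳ : ∀ i → Arc (inj₂ i) (inj₁ (next i))
      arcʳ i = (next i , i) , ((≡.refl , ≢-sym (i≢next[i] i)) , best) , ≡.refl
        where
        best : ∀ e → AvailableAt (inj₂ i) e →
               gain (inj₂ i) e ≤ gain (inj₂ i) (next i , i) ×
               (gain (inj₂ i) e ≈ gain (inj₂ i) (next i , i) → (next i , i) ≼ e)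
        -- `weight` takes the left label first; swapping its arguments turns gains at right vertices
        -- into `labelGain`.
        best (j , _) (≡.refl , j≢i) rewrite weight-sym j i | weight-sym (next i) i =
          proj₁ (prefers-next i j (≢-sym j≢i)) , proj₂ ∘ proj₂ (prefers-next i j (≢-sym j≢i))

      -- Each arc changes side and advances the label. Since 3 is odd, the labels run round twice
      -- before the cycle closes.
      vertex : Fin 6 → Vertex ℝ 3 3
      vertex = lookup (inj₁ 0F ∷ inj₂ 1F ∷ inj₁ 2F ∷ inj₂ 0F ∷ inj₁ 1F ∷ inj₂ 2F ∷ [])

      vertex-injective : Injective _≡_ _≡_ vertex
      vertex-injective {i} {j} = from-yes (all? λ i → all? λ j →
        Sum.≡-dec Fin._≟_ Fin._≟_ (vertex i) (vertex j) →-dec i Fin.≟ j) i j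

      longCycle : LongProposalCycle
      longCycle = record
        { k         = 5
        ; long      = s≤s (s≤s (s≤s (s≤s z≤n)))
        ; vertex    = vertex
        ; injective = vertex-injective
        ; step      = λ { 0F → arcˡ 0F ; 1F → arcʳ 1F ; 2F → arcˡ 2F ; 3F → arcʳ 0F ; 4F → arcˡ 1F }
        ; close     = arcʳ 2F
        }

    -- Constructing a balanced function from the absence of long cycles.

    module _ (longCycleFree : LongCycleFree ℝ g) where

      triangle-≤ : ∀ x y z → G y z * (G z x * G x y) ≤ G y x * (G x z * G z y)
      triangle-≤ x y z gap = longCycleFree hexagon [ ρ , ρ ]′ _≼_ ≼-isTotalOrder longCycle
        where open Hexagon x y z gap

      -- Kolmogorov's criterion for three states. Exchanging `x` and `z` swaps the two products, so
      -- the one-sided bound gives both directions.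
      triangle : ∀ x y z → G y z * (G z x * G x y) ≈ G y x * (G x z * G z y)
      triangle x y z = ≤-antisym (triangle-≤ x y z) (triangle-≤ z y x)

      -- The value forced by balance against `0ᴿ` under the normalisation `h 0ᴿ = 1`.
      ratio : Func ([0,1⟩ ℝ) (⟨0,∞⟩ ℝ)
      ratio = record
        { to   = λ y → (G 0ᴿ y , G-pos 0ᴿ y) ÷⁺ (G y 0ᴿ , G-pos y 0ᴿ)
        ; cong = λ {x} {y} x≈y → ÷-cong (G x 0ᴿ , G-pos x 0ᴿ) (G y 0ᴿ , G-pos y 0ᴿ)
            (Func.cong g (refl , x≈y)) (Func.cong g (x≈y , refl))
        }

      -- Cleared of denominators, this is the cycle identity for `x`, `y` and `0ᴿ`.
      ratio-balanced : Balanced (ratio ⟨$⟩_)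
      ratio-balanced x y = cross-multiply (G x 0ᴿ , G-pos x 0ᴿ) (G y 0ᴿ , G-pos y 0ᴿ) (triangle x y 0ᴿ)

theorem2p1 : ∀ {c ℓ₁ ℓ₂} (ℝ : RealNumbers c ℓ₁ ℓ₂) → let open RealNumbers ℝ in
    (g : Rule ℝ) → (∀ x y → ⟦_⟧ ℝ g x y + ⟦_⟧ ℝ g y x ≈ 1#) →
    (LongCycleFree ℝ g ⇔ (Σ[ h ∈ Func ([0,1⟩ ℝ) (⟨0,∞⟩ ℝ) ] Represents ℝ h g))
    × (∀ (h h′ : Func ([0,1⟩ ℝ) (⟨0,∞⟩ ℝ)) → Represents ℝ h g → Represents ℝ h′ g →
    Σ[ a ∈ Positive ℝ ] (∀ x → proj₁ (h′ ⟨$⟩ x) ≈ proj₁ a * proj₁ (h ⟨$⟩ x)))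
theorem2p1 ℝ g complementary =
  mk⇔ (λ (longCycleFree : LongCycleFree ℝ g) →
         let h = ratio ℝ g longCycleFree in
         h , balanced⇒represents ℝ g complementary h (ratio-balanced ℝ g longCycleFree))
      (λ (h , rep) → balanced⇒longCycleFree ℝ g (h ⟨$⟩_) (balanced h rep)) ,
  λ h h′ rep rep′ →
    balanced-unique ℝ g (h ⟨$⟩_) (h′ ⟨$⟩_) (balanced h rep) (balanced h′ rep′)
  where
  balanced : ∀ h → Represents ℝ h g → Balanced ℝ g (h ⟨$⟩_)
  balanced = represents⇒balanced ℝ g complementary
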